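{- There exist sets $A,B\subseteq\Sigma^*$ such that $B\leq^p_T A$, $B\not\leq^p_{lni\text{ - }T}A$, and $B\not\leq^p_{lnd\text{ - }T}A$.
   Context: $\Sigma=\{0,1\}$; $|x|$ is the length of $x$. A DPTM is a deterministic oracle Turing machine $M$ for which there is one polynomial $p$ such that, for every oracle $X\subseteq\Sigma^*$ and input $x$, $M^X(x)$ halts within $p(|x|)$ steps; $L(M^X)$ is the set of inputs accepted with oracle $X$. $B\leq^p_T A$: there is a DPTM $M$ with $L(M^A)=B$. $B\leq^p_{lni\text{ - }T}A$ (respectively $B\leq^p_{lnd\text{ - }T}A$): there is a DPTM $M$ with $L(M^A)=B$ such that for every input $x$ the sequence $q_1,\dots,q_k$ ($k\ge0$), in order, of queries made by $M^A(x)$ to its oracle satisfies $|q_1|\ge|q_2|\ge\dots\ge|q_k|$ (respectively $|q_1|\le|q_2|\le\dots\le|q_k|$). -}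

module Defs where

open import Data.Bool using (Bool; if_then_else_)
open import Data.Fin using (Fin)
open import Data.List using (List; []; _∷_; _∷ʳ_; length; map; foldr)
open import Data.List.Relation.Unary.Linked using (Linked)
open import Data.Maybe as Maybe using (Maybe; just; nothing; Is-just; to-witness)
open import Data.Nat using (ℕ; zero; suc; _+_; _*_; _≤_; _≥_)
open import Data.Product using (_×_; _,_; proj₁; proj₂; ∃-syntax; map₁)
open import Data.Vec as Vec using (Vec; _∷_)
open import Relation.Binary.PropositionalEquality using (_≗_)

Word : Set
Word = List Bool

-- Subsets of {0,1}* are given by characteristic functions, so that an oracle
-- can be any of them and every query has an answer.
Language : Set
Language = Word → Bool

-- Coefficient lists, constant term first.
Polynomial : Set
Polynomial = List ℕ

eval : Polynomial → ℕ → ℕ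
eval p n = foldr (λ a v → a + n * v) 0 p

data Symbol (g : ℕ) : Set where
  bit   : Bool → Symbol g
  blank : Symbol g
  aux   : Fin g → Symbol g

data Direction : Set where
  left right stay : Direction

-- A two-way infinite tape: the cells to the left of the head (nearest first),
-- the scanned cell, and the cells to the right of the head (nearest first).
-- All cells not listed are blank.
record Tape (g : ℕ) : Set where
  constructor tape
  field
    before  : List (Symbol g)
    scanned : Symbol g
    after   : List (Symbol g)

open Tape public

write : ∀ {g} → Symbol g → Tape g → Tape g
write a (tape ls _ rs) = tape ls a rs

shift : ∀ {g} → Direction → Tape g → Tape g
shift left  (tape []       a rs)       = tape [] blank (a ∷ rs)
shift left  (tape (l ∷ ls) a rs)       = tape ls l (a ∷ rs)
shift right (tape ls       a [])       = tape (a ∷ ls) blank []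
shift right (tape ls       a (r ∷ rs)) = tape (a ∷ ls) r rs
shift stay  t                          = t

blankTape : ∀ {g} → Tape g
blankTape = tape [] blank []

inputTape : ∀ {g} → Word → Tape g
inputTape []      = blankTape
inputTape (b ∷ x) = tape [] (bit b) (map bit x)

-- Instructions of a machine with s states, k work tapes and g auxiliary tape
-- symbols.  The query tape is one-way and write-only: `work` may append one
-- bit to it, and `query` asks the oracle about the word written on it, erases
-- it, and continues in a state depending on the answer.
data Instruction (s k g : ℕ) : Set where
  halt  : (accept : Bool) → Instruction s k g
  query : (ifNo ifYes : Fin s) → Instruction s k g
  work  : (next : Fin s) → Vec (Symbol g × Direction) k → Maybe Bool →
          Instruction s k g

-- The first of the 1 + extraTapes work tapes initially holds the input.
record OracleTM : Set where
  field
    states     : ℕ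
    extraTapes : ℕ
    auxSymbols : ℕ
    start      : Fin states
    program    : Fin states → Vec (Symbol auxSymbols) (suc extraTapes) →
                 Instruction states (suc extraTapes) auxSymbols

module Run (M : OracleTM) where
  open OracleTM M

  record Config : Set where
    constructor config
    field
      state     : Fin states
      tapes     : Vec (Tape auxSymbols) (suc extraTapes)
      queryTape : Word

  initial : Word → Config
  initial x = config start (inputTape x ∷ Vec.replicate extraTapes blankTape) []

  data Step : Set where
    halted : (accept : Bool) → Step
    asked  : (q : Word) → Config → Step
    worked : Config → Step

  append : Maybe Bool → Word → Word
  append nothing  w = w
  append (just b) w = w ∷ʳ b

  perform : Language → Instruction states (suc extraTapes) auxSymbols → Config → Step
  perform X (halt a)           c               = halted a
  perform X (query ifNo ifYes) (config _ ts w) =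
    asked w (config (if X w then ifYes else ifNo) ts [])
  perform X (work s acts m)    (config _ ts w) =
    worked (config s (Vec.zipWith (λ (a , d) t → shift d (write a t)) acts ts)
                   (append m w))

  step : Language → Config → Step
  step X c = perform X (program (Config.state c) (Vec.map scanned (Config.tapes c))) c

  -- The sequence of queries asked and the verdict, provided that the
  -- computation from the given configuration halts within t steps.
  runFrom : Language → ℕ → Config → Maybe (List Word × Bool)
  resume  : Language → ℕ → Step → Maybe (List Word × Bool)

  runFrom X t c = resume X t (step X c)

  resume X t       (halted a)  = just ([] , a)
  resume X zero    (asked _ _) = nothing
  resume X zero    (worked _)  = nothing
  resume X (suc t) (asked q c) = Maybe.map (map₁ (q ∷_)) (runFrom X t c)
  resume X (suc t) (worked c)  = runFrom X t c

run : OracleTM → Language → ℕ → Word → Maybe (List Word × Bool)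
run M X t x = Run.runFrom M X t (Run.initial M x)

record DPTM : Set where
  field
    machine : OracleTM
    bound   : Polynomial
    halts   : ∀ X x → Is-just (run machine X (eval bound (length x)) x)

  outcome : Language → Word → List Word × Bool
  outcome X x = to-witness (halts X x)

queries : DPTM → Language → Word → List Word
queries M X x = proj₁ (DPTM.outcome M X x)

L : DPTM → Language → Language
L M X x = proj₂ (DPTM.outcome M X x)

infix 4 _≤ᵖ-T_ _≤ᵖ-lni-T_ _≤ᵖ-lnd-T_

_≤ᵖ-T_ : Language → Language → Set
B ≤ᵖ-T A = ∃[ M ] L M A ≗ B

_≤ᵖ-lni-T_ : Language → Language → Set
B ≤ᵖ-lni-T A = ∃[ M ] (L M A ≗ B ×
  (∀ x → Linked (λ u v → length u ≥ length v) (queries M A x)))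

_≤ᵖ-lnd-T_ : Language → Language → Set
B ≤ᵖ-lnd-T A = ∃[ M ] (L M A ≗ B ×
  (∀ x → Linked (λ u v → length u ≤ length v) (queries M A x)))

{-# OPTIONS --safe #-}

-- Let B be decided from A by the following procedure, which depends only on the
-- length n of the input.  The oracle's answers to 0ⁿ, 0ⁿ⁻¹1, …, 01ⁿ⁻¹ spell a
-- word y of length n from right to left, and the verdict is the answer to a
-- final query, which has length n + 1 or n - 1 and determines y; the first bit
-- of y says which.  A machine whose query lengths only decrease has to ask a
-- query of length n + 1 before it can see anything of y, and dually for
-- increasing lengths and n - 1.  If its running time is below 2ⁿ⁻¹, some y is
-- therefore never asked for, so A can be fixed at y's final query to make the
-- machine err.  Doing this for all clocked machines in turn, at lengths beyond
-- everything the earlier stages looked at, yields A.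
module Submission where

open import Defs
open import Data.Bool using (Bool; true; false; if_then_else_; not)
import Data.Bool.Properties as Bool
open import Data.Fin using (Fin; zero; suc)
open import Data.Fin.Properties using (*↔×)
open import Data.List
  using (List; []; _∷_; _++_; _ʳ++_; length; map; reverse; replicate; drop)
open import Data.List.Properties
import Data.List.Membership.DecPropositional as DecMembership
open import Data.List.Membership.Propositional using (_∈_; _∉_)
open import Data.List.Membership.Propositional.Properties using (∈-map⁺)
open import Data.List.Relation.Unary.All as All using (All; []; _∷_)
open import Data.List.Relation.Unary.AllPairs using (AllPairs; _∷_)
open import Data.List.Relation.Unary.Any using (here; there)
open import Data.List.Relation.Unary.Linked using (Linked)
open import Data.List.Relation.Unary.Linked.Properties using (Linked⇒AllPairs)
open import Data.Maybe as Maybe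
  using (Maybe; just; nothing; _>>=_; Is-just; to-witness; fromMaybe)
open import Data.Maybe.Properties using (just-injective)
import Data.Maybe.Relation.Unary.Any as MaybeAny
open import Data.Nat
open import Data.Nat.Binary as ℕᵇ using (ℕᵇ; 2[1+_]; 1+[2_])
open import Data.Nat.Binary.Properties using (fromℕ-toℕ)
open import Data.Nat.ListAction using (sum)
open import Data.Nat.Properties
open import Data.Nat.Solver using (module +-*-Solver)
open import Data.Product using (Σ; _×_; _,_; proj₁; proj₂; ∃-syntax; map₁)
open import Data.Product.Function.NonDependent.Propositional using (_×-↪_)
open import Data.Sum using (_⊎_; inj₁; inj₂)
open import Data.Unit using (⊤; tt)
open import Data.Vec as Vec using (Vec; []; _∷_)
open import Data.Vec.Properties using (lookup∘tabulate; toList∘fromList)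
open import Function using (_∘_; id; _↪_; mk↪; RightInverse)
open import Function.Construct.Composition using (_↪-∘_)
open import Function.Construct.Identity using (↪-id)
open import Function.Properties.Inverse using (↔⇒↪; ↔-sym)
open import Level using (0ℓ)
open import Relation.Binary.Core using (Rel)
open import Relation.Binary.PropositionalEquality
open import Relation.Nullary using (¬_; Dec; does; yes; no; contradiction)
open import Relation.Nullary.Decidable using (dec-true; dec-false)

-- Runs of an arbitrary machine

map-just⁻¹ : ∀ {A B : Set} {f : A → B} {y} m → Maybe.map f m ≡ just y →
             ∃[ x ] (m ≡ just x × f x ≡ y)
map-just⁻¹ (just x) refl = x , refl , refl

_≟ʷ_ : (u v : Word) → Dec (u ≡ v)
_≟ʷ_ = ≡-dec Bool._≟_

module Computations (M : OracleTM) where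
  open OracleTM M
  open Run M

  -- Each query costs one step. Here and below `go` takes the instruction as an argument of its own,
  -- so that splitting on it lets `perform` reduce.
  length-queries : ∀ X t c {qs a} → runFrom X t c ≡ just (qs , a) → length qs ≤ t
  length-queries X t c = go t (program (Config.state c) (Vec.map scanned (Config.tapes c))) c
    where
    go : ∀ t i c {qs a} → resume X t (perform X i c) ≡ just (qs , a) → length qs ≤ t
    go t       (halt _)      c refl = z≤n
    go (suc t) (query n y) c eq with map-just⁻¹ (runFrom X t _) eq
    ... | _ , eq′ , refl = s≤s (length-queries X t _ eq′)
    go (suc t) (work _ _ _)  c eq = m≤n⇒m≤1+n (length-queries X t _ eq)

  length-append : ∀ m w → length (append m w) ≤ suc (length w)
  length-append nothing  w = n≤1+n _
  length-append (just b) w = ≤-reflexive (trans (length-++ w) (+-comm _ 1))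

  -- A step appends at most one bit and a query empties the query tape, so the length written plus
  -- the time left never grows.
  queries-short : ∀ X t c {qs a} → runFrom X t c ≡ just (qs , a) →
                  All (λ q → length q ≤ length (Config.queryTape c) + t) qs
  queries-short X t c = go t (program (Config.state c) (Vec.map scanned (Config.tapes c))) c
    where
    go : ∀ t i c {qs a} → resume X t (perform X i c) ≡ just (qs , a) →
         All (λ q → length q ≤ length (Config.queryTape c) + t) qs
    go t       (halt _)      c refl = []
    go (suc t) (query n y) c eq with map-just⁻¹ (runFrom X t _) eq
    ... | _ , eq′ , refl =
      m≤m+n _ _ ∷ All.map (λ le → ≤-trans le (≤-trans (n≤1+n t) (m≤n+m _ _)))
                          (queries-short X t _ eq′)
    go (suc t) (work s as m) c@(config _ _ w) eq =
      All.map (λ le → ≤-trans le (≤-trans (+-monoˡ-≤ t (length-append m w))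
                                          (≤-reflexive (sym (+-suc (length w) t)))))
              (queries-short X t _ eq)

  run-agree : ∀ {X Y} t c {qs a} → runFrom X t c ≡ just (qs , a) →
              All (λ q → X q ≡ Y q) qs → runFrom Y t c ≡ just (qs , a)
  run-agree {X} {Y} t c = go t (program (Config.state c) (Vec.map scanned (Config.tapes c))) c
    where
    go : ∀ t i c {qs a} → resume X t (perform X i c) ≡ just (qs , a) →
         All (λ q → X q ≡ Y q) qs → resume Y t (perform Y i c) ≡ just (qs , a)
    go t       (halt _)      c eq _ = eq
    go (suc t) (query n y) (config _ ts w) eq all with map-just⁻¹ (runFrom X t _) eq
    go (suc t) (query n y) (config _ ts w) eq (p ∷ all) | _ , eq′ , refl
      rewrite sym p | run-agree {X} {Y} t _ eq′ all = refl
    go (suc t) (work s as m) c eq all = run-agree {X} {Y} t _ eq all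

  -- Up to its first occurrence in one run, the query w is preceded only by
  -- queries on which both oracles agree, so the other run reaches it as well.
  query-transfer : ∀ {_~_ : Rel Word 0ℓ} {X Y w} t c {qs a rs b} →
                   runFrom X t c ≡ just (qs , a) → runFrom Y t c ≡ just (rs , b) →
                   AllPairs _~_ qs → w ∈ qs →
                   (∀ {q} → q ∈ qs → q ~ w → q ≢ w → X q ≡ Y q) → w ∈ rs
  query-transfer {_~_} {X} {Y} {w} t c =
    go t (program (Config.state c) (Vec.map scanned (Config.tapes c))) c
    where
    go : ∀ t i c {qs a rs b} → resume X t (perform X i c) ≡ just (qs , a) →
         resume Y t (perform Y i c) ≡ just (rs , b) → AllPairs _~_ qs → w ∈ qs →
         (∀ {q} → q ∈ qs → q ~ w → q ≢ w → X q ≡ Y q) → w ∈ rs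
    go t (halt _) c refl _ _ () _
    go (suc t) (work _ _ _) c eqX eqY = query-transfer {_~_} {X} {Y} {w} t _ eqX eqY
    go (suc t) (query n y) (config _ ts q) eqX eqY ord w∈ agree
      with map-just⁻¹ (runFrom X t _) eqX | map-just⁻¹ (runFrom Y t _) eqY | q ≟ʷ w
    ... | _ , eqX′ , refl | _ , eqY′ , refl | yes q≡w = here (sym q≡w)
    go (suc t) (query n y) (config _ ts q) eqX eqY ord (here w≡q) agree
      | _ , eqX′ , refl | _ , eqY′ , refl | no q≢w = contradiction (sym w≡q) q≢w
    go (suc t) (query n y) (config _ ts q) eqX eqY (q~ ∷ ord) (there w∈) agree
      | _ , eqX′ , refl | _ , eqY′ , refl | no q≢w
      rewrite agree (here refl) (All.lookup q~ w∈) q≢w =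
      there (query-transfer {_~_} {X} {Y} {w} t _ eqX′ eqY′ ord w∈ (λ q∈ → agree (there q∈)))

-- The machine that reduces B to A

-- A bit is an input cell that is still to be overwritten, a mark the oracle's
-- answer written over one.
mark : Bool → Symbol 2
mark false = aux zero
mark true  = aux (suc zero)

pattern scan     = zero
pattern copy     = suc zero
pattern back₀    = suc (suc zero)
pattern back₁    = suc (suc (suc zero))
pattern rewind   = suc (suc (suc (suc zero)))
pattern final    = suc (suc (suc (suc (suc zero))))
pattern rejected = suc (suc (suc (suc (suc (suc zero)))))
pattern accepted = suc (suc (suc (suc (suc (suc (suc zero))))))

back : Bool → Fin 8
back b = if b then back₁ else back₀

move : Fin 8 → Symbol 2 → Direction → Maybe Bool → Instruction 8 1 2
move s a d m = work s ((a , d) ∷ []) m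

-- With u bits and v marks on the tape, a round through `scan`, `copy`, `back` and `rewind` asks
-- 0ᵘ1ᵛ and overwrites the rightmost bit with the answer. A mark at the left end therefore means
-- that no bit remains; `scan` then skips a `false` there or doubles a `true`, which sets the length
-- of the final query.
δ : Fin 8 → Symbol 2 → Instruction 8 1 2
δ scan     blank            = query rejected accepted
δ scan     (bit b)          = move copy (bit b) stay nothing
δ scan     (aux zero)       = move final (mark false) right nothing
δ scan     (aux (suc zero)) = move final (mark true) stay (just true)
δ copy     blank            = query back₀ back₁
δ copy     (bit b)          = move copy (bit b) right (just false)
δ copy     (aux i)          = move copy (aux i) right (just true)
δ back₀    blank            = move back₀ blank left nothing
δ back₀    (bit _)          = move rewind (mark false) left nothing
δ back₀    (aux i)          = move back₀ (aux i) left nothing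
δ back₁    blank            = move back₁ blank left nothing
δ back₁    (bit _)          = move rewind (mark true) left nothing
δ back₁    (aux i)          = move back₁ (aux i) left nothing
δ rewind   blank            = move scan blank right nothing
δ rewind   (bit b)          = move rewind (bit b) left nothing
δ rewind   (aux _)          = halt false
δ final    blank            = query rejected accepted
δ final    (bit _)          = halt false
δ final    (aux zero)       = move final (aux zero) right (just false)
δ final    (aux (suc zero)) = move final (aux (suc zero)) right (just true)
δ rejected _                = halt false
δ accepted _                = halt true

solver : OracleTM
solver = record
  { states = 8 ; extraTapes = 0 ; auxSymbols = 2 ; start = scan
  ; program = λ { s (a ∷ []) → δ s a } }

open Run solver

-- The head stands on the nearest cell of the right-hand list, or of the left-hand list for `loadˡ`.
-- Moves can then be stated without distinguishing whether a listed cell comes next.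
loadʳ : List (Symbol 2) → List (Symbol 2) → Tape 2
loadʳ ls []       = tape ls blank []
loadʳ ls (r ∷ rs) = tape ls r rs

loadˡ : List (Symbol 2) → List (Symbol 2) → Tape 2
loadˡ []       rs = tape [] blank rs
loadˡ (l ∷ ls) rs = tape ls l rs

shift-right : ∀ ls a rs → shift right (tape ls a rs) ≡ loadʳ (a ∷ ls) rs
shift-right ls a []      = refl
shift-right ls a (_ ∷ _) = refl

shift-left : ∀ ls a rs → shift left (tape ls a rs) ≡ loadˡ ls (a ∷ rs)
shift-left []      a rs = refl
shift-left (_ ∷ _) a rs = refl

at : Fin 8 → Tape 2 → Word → Config
at s t w = config s (t ∷ []) w

move-right : ∀ X t s s′ a a′ m → δ s a ≡ move s′ a′ right m → ∀ ls rs w →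
  runFrom X (suc t) (at s (tape ls a rs) w) ≡
  runFrom X t (at s′ (loadʳ (a′ ∷ ls) rs) (append m w))
move-right X t s s′ a a′ m p ls rs w rewrite p | shift-right ls a′ rs = refl

move-left : ∀ X t s s′ a a′ → δ s a ≡ move s′ a′ left nothing → ∀ ls rs w →
  runFrom X (suc t) (at s (tape ls a rs) w) ≡ runFrom X t (at s′ (loadˡ ls (a′ ∷ rs)) w)
move-left X t s s′ a a′ p ls rs w rewrite p | shift-left ls a′ rs = refl

sweep-right : ∀ X t s (cell : Bool → Symbol 2) (out : Bool → Bool) →
  (∀ b → δ s (cell b) ≡ move s (cell b) right (just (out b))) → ∀ bs ls rs w →
  runFrom X (length bs + t) (at s (loadʳ ls (map cell bs ++ rs)) w) ≡
  runFrom X t (at s (loadʳ (map cell bs ʳ++ ls) rs) (w ++ map out bs))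
sweep-right X t s cell out p [] ls rs w rewrite ++-identityʳ w = refl
sweep-right X t s cell out p (b ∷ bs) ls rs w
  rewrite move-right X (length bs + t) s s (cell b) (cell b) _ (p b) ls (map cell bs ++ rs) w
        | sweep-right X t s cell out p bs (cell b ∷ ls) rs (w ++ out b ∷ [])
        | ++-assoc w (out b ∷ []) (map out bs) = refl

sweep-left : ∀ X t s (cell : Bool → Symbol 2) →
  (∀ b → δ s (cell b) ≡ move s (cell b) left nothing) → ∀ bs ls rs w →
  runFrom X (length bs + t) (at s (loadˡ (map cell bs ++ ls) rs) w) ≡
  runFrom X t (at s (loadˡ ls (map cell bs ʳ++ rs)) w)
sweep-left X t s cell p [] ls rs w = refl
sweep-left X t s cell p (b ∷ bs) ls rs w
  rewrite move-left X (length bs + t) s s (cell b) (cell b) (p b) (map cell bs ++ ls) rs w =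
  sweep-left X t s cell p bs ls (cell b ∷ rs) w

map-reverse-++ : ∀ {A B : Set} (f : A → B) xs {ys} → map f (reverse xs) ++ ys ≡ map f xs ʳ++ ys
map-reverse-++ f xs = trans (cong (_++ _) (reverse-map f xs)) (sym (ʳ++-defn (map f xs)))

map-reverse-ʳ++ : ∀ {A B : Set} (f : A → B) xs {ys} → map f (reverse xs) ʳ++ ys ≡ map f xs ++ ys
map-reverse-ʳ++ f xs {ys} = trans (cong (_ʳ++ ys) (reverse-map f xs)) (ʳ++-ʳ++ (map f xs))

map-const : ∀ {A B : Set} (b : B) (xs : List A) → map (λ _ → b) xs ≡ replicate (length xs) b
map-const b []       = refl
map-const b (_ ∷ xs) = cong (b ∷_) (map-const b xs)

-- For cells listed from right to left but crossed from left to right, as the unwritten bits are in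
-- `copying`.
sweep-right′ : ∀ X t s (cell : Bool → Symbol 2) (out : Bool → Bool) →
  (∀ b → δ s (cell b) ≡ move s (cell b) right (just (out b))) → ∀ bs ls rs w →
  runFrom X (length bs + t) (at s (loadʳ ls (map cell bs ʳ++ rs)) w) ≡
  runFrom X t (at s (loadʳ (map cell bs ++ ls) rs) (w ++ map out (reverse bs)))
sweep-right′ X t s cell out p bs ls rs w
  with sweep-right X t s cell out p (reverse bs) ls rs w
... | eq rewrite map-reverse-++ cell bs {rs} | map-reverse-ʳ++ cell bs {ls} | length-reverse bs = eq

sweep-left′ : ∀ X t s (cell : Bool → Symbol 2) →
  (∀ b → δ s (cell b) ≡ move s (cell b) left nothing) → ∀ bs ls rs w →
  runFrom X (length bs + t) (at s (loadˡ (map cell bs ʳ++ ls) rs) w) ≡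
  runFrom X t (at s (loadˡ ls (map cell bs ++ rs)) w)
sweep-left′ X t s cell p bs ls rs w with sweep-left X t s cell p (reverse bs) ls rs w
... | eq rewrite map-reverse-++ cell bs {ls} | map-reverse-ʳ++ cell bs {rs} | length-reverse bs = eq

-- Whether a blank beyond the end of the cells is listed depends on whether the
-- head has been there before.
edge : Bool → List (Symbol 2)
edge b = if b then blank ∷ [] else []

loadʳ-edge : ∀ ls b → loadʳ ls (edge b) ≡ tape ls blank []
loadʳ-edge ls false = refl
loadʳ-edge ls true  = refl

loadˡ-edge : ∀ b rs → loadˡ (edge b) rs ≡ tape [] blank rs
loadˡ-edge false rs = refl
loadˡ-edge true  rs = refl

unfilled filled : Word → List (Symbol 2)
unfilled = map bit
filled   = map mark

-- A round starts at the left end of the cells; us lists the bits not yet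
-- overwritten from right to left, ys the answers from left to right.
roundStart : Bool → Bool → Word → Word → Config
roundStart l r us ys = at scan (loadʳ (edge l) (unfilled us ʳ++ filled ys ++ edge r)) []

address : ℕ → Word → Word
address u ys = replicate u false ++ map (λ _ → true) ys

-- Lets the `scan` step compute: while a bit remains, the left end holds one, whichever it is.
leftmost-bit : ∀ us b zs → ∃[ c ] ∃[ cs ] unfilled us ʳ++ (bit b ∷ zs) ≡ bit c ∷ cs
leftmost-bit []       b zs = b , zs , refl
leftmost-bit (c ∷ us) b zs = leftmost-bit us c (bit b ∷ zs)

copying : ∀ X t l r b us ys →
  runFrom X (1 + (length (b ∷ us) + (length ys + t))) (roundStart l r (b ∷ us) ys) ≡
  runFrom X t (at copy (tape (filled ys ʳ++ unfilled (b ∷ us) ++ edge l) blank [])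
                       (address (length (b ∷ us)) ys))
copying X t l r b us ys = begin
  runFrom X (1 + (length (b ∷ us) + (length ys + t))) (roundStart l r (b ∷ us) ys)
    ≡⟨ depart ⟩
  runFrom X (length (b ∷ us) + (length ys + t))
    (at copy (loadʳ (edge l) (unfilled (b ∷ us) ʳ++ filled ys ++ edge r)) [])
    ≡⟨ sweep-right′ X _ copy bit (λ _ → false) (λ _ → refl) (b ∷ us) (edge l) _ [] ⟩
  runFrom X (length ys + t)
    (at copy (loadʳ (unfilled (b ∷ us) ++ edge l) (filled ys ++ edge r))
             (map (λ _ → false) (reverse (b ∷ us))))
    ≡⟨ sweep-right X t copy mark (λ _ → true) (λ { false → refl ; true → refl }) ys _ _ _ ⟩
  runFrom X t
    (at copy (loadʳ (filled ys ʳ++ unfilled (b ∷ us) ++ edge l) (edge r))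
             (map (λ _ → false) (reverse (b ∷ us)) ++ map (λ _ → true) ys))
    ≡⟨ cong₂ (λ T z → runFrom X t (at copy T (z ++ map (λ _ → true) ys)))
         (loadʳ-edge _ r)
         (trans (map-const false (reverse (b ∷ us)))
                (cong (λ k → replicate k false) (length-reverse (b ∷ us)))) ⟩
  runFrom X t (at copy (tape (filled ys ʳ++ unfilled (b ∷ us) ++ edge l) blank [])
                       (address (length (b ∷ us)) ys)) ∎
  where
  open ≡-Reasoning
  depart : runFrom X (1 + (length (b ∷ us) + (length ys + t))) (roundStart l r (b ∷ us) ys) ≡
           runFrom X (length (b ∷ us) + (length ys + t))
             (at copy (loadʳ (edge l) (unfilled (b ∷ us) ʳ++ filled ys ++ edge r)) [])
  depart with leftmost-bit us b (filled ys ++ edge r)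
  ... | _ , _ , eq rewrite eq = refl

-- By the end the head has visited the blanks at both ends, so both are listed from the second round
-- on.
returning : ∀ X t β l b us ys →
  runFrom X (1 + (length ys + (1 + (length us + (1 + t)))))
    (at (back β) (tape (filled ys ʳ++ unfilled (b ∷ us) ++ edge l) blank []) []) ≡
  runFrom X t (roundStart true true us (β ∷ ys))
returning X t β l b us ys = begin
  runFrom X (1 + (length ys + (1 + (length us + (1 + t)))))
    (at (back β) (tape (filled ys ʳ++ unfilled (b ∷ us) ++ edge l) blank []) [])
    ≡⟨ move-left X _ (back β) (back β) blank blank (turns β) _ [] [] ⟩
  runFrom X (length ys + (1 + (length us + (1 + t))))
    (at (back β) (loadˡ (filled ys ʳ++ unfilled (b ∷ us) ++ edge l) (blank ∷ [])) [])
    ≡⟨ sweep-left′ X _ (back β) mark (passes β) ys _ _ [] ⟩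
  runFrom X (1 + (length us + (1 + t)))
    (at (back β) (tape (unfilled us ++ edge l) (bit b) (filled ys ++ blank ∷ [])) [])
    ≡⟨ move-left X _ (back β) rewind (bit b) (mark β) (fills β) (unfilled us ++ edge l) _ [] ⟩
  runFrom X (length us + (1 + t))
    (at rewind (loadˡ (unfilled us ++ edge l) (mark β ∷ filled ys ++ blank ∷ [])) [])
    ≡⟨ sweep-left X _ rewind bit (λ _ → refl) us _ _ [] ⟩
  runFrom X (1 + t)
    (at rewind (loadˡ (edge l) (unfilled us ʳ++ mark β ∷ filled ys ++ blank ∷ [])) [])
    ≡⟨ cong (λ T → runFrom X (1 + t) (at rewind T [])) (loadˡ-edge l _) ⟩
  runFrom X (1 + t)
    (at rewind (tape [] blank (unfilled us ʳ++ mark β ∷ filled ys ++ blank ∷ [])) [])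
    ≡⟨ move-right X t rewind scan blank blank nothing refl []
         (unfilled us ʳ++ mark β ∷ filled ys ++ blank ∷ []) [] ⟩
  runFrom X t (roundStart true true us (β ∷ ys)) ∎
  where
  open ≡-Reasoning
  passes : ∀ β c → δ (back β) (mark c) ≡ move (back β) (mark c) left nothing
  passes false false = refl
  passes false true  = refl
  passes true  false = refl
  passes true  true  = refl
  turns : ∀ β → δ (back β) blank ≡ move (back β) blank left nothing
  turns false = refl
  turns true  = refl
  fills : ∀ β → δ (back β) (bit b) ≡ move rewind (mark β) left nothing
  fills false = refl
  fills true  = refl

round : ∀ X t l r b us ys → let q = address (length (b ∷ us)) ys in
  runFrom X (2 * (length (b ∷ us) + length ys) + 4 + t) (roundStart l r (b ∷ us) ys) ≡
  Maybe.map (map₁ (q ∷_)) (runFrom X t (roundStart true true us (X q ∷ ys)))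
round X t l r b us ys = begin
  runFrom X (2 * (length (b ∷ us) + length ys) + 4 + t) (roundStart l r (b ∷ us) ys)
    -- With n cells, it takes n + 2 steps to leave `scan`, cross the cells and ask, and n + 2 to
    -- step off the right blank, recross the cells and step off the left blank.
    ≡⟨ cong (λ T → runFrom X T (roundStart l r (b ∷ us) ys)) (time (length us) (length ys) t) ⟩
  runFrom X (1 + (length (b ∷ us) + (length ys + (1 + t′)))) (roundStart l r (b ∷ us) ys)
    ≡⟨ copying X (1 + t′) l r b us ys ⟩
  Maybe.map (map₁ (address (length (b ∷ us)) ys ∷_)) (runFrom X t′
    (at (back (X q)) (tape (filled ys ʳ++ unfilled (b ∷ us) ++ edge l) blank []) []))
    ≡⟨ cong (Maybe.map (map₁ (q ∷_))) (returning X t (X q) l b us ys) ⟩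
  Maybe.map (map₁ (q ∷_)) (runFrom X t (roundStart true true us (X q ∷ ys))) ∎
  where
  open ≡-Reasoning
  q : Word
  q = address (length (b ∷ us)) ys
  t′ : ℕ
  t′ = 1 + (length ys + (1 + (length us + (1 + t))))
  open +-*-Solver
  time : ∀ u y t → 2 * (suc u + y) + 4 + t ≡
                   1 + (suc u + (y + (1 + (1 + (y + (1 + (u + (1 + t))))))))
  time = solve 3 (λ u y t → con 2 :* (con 1 :+ u :+ y) :+ con 4 :+ t :=
    con 1 :+ (con 1 :+ u :+ (y :+ (con 1 :+ (con 1 :+ (y :+ (con 1 :+ (u :+ (con 1 :+ t))))))))) refl

-- The first bit moves the length one up or one down, so the final query never has the length of the
-- earlier ones; once that bit is known, the rest of the word can be read off the query.
target : Word → Word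
target (true  ∷ y) = true ∷ true ∷ y
target (false ∷ y) = y
target []          = []

fill : Language → ℕ → Word → Word
fill X zero    ys = ys
fill X (suc u) ys = fill X u (X (address (suc u) ys) ∷ ys)

-- The two extra steps are the one out of `scan` and the query; halting takes none. After a leading
-- `false` one step is left over, because the first move already passes that cell.
finish : ∀ X t l r ys → ∃[ qs ]
  runFrom X (length ys + 2 + t) (roundStart l r [] ys) ≡ just (qs , X (target ys))
finish X t l r ys = target ys ∷ [] , go ys
  where
  answer : ∀ ls w t → runFrom X (suc t) (at final (loadʳ ls (edge r)) w) ≡
                      just (w ∷ [] , X w)
  answer ls w t rewrite loadʳ-edge ls r with X w
  ... | false = refl
  ... | true  = refl
  go : ∀ ys → runFrom X (length ys + 2 + t) (roundStart l r [] ys) ≡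
              just (target ys ∷ [] , X (target ys))
  go [] rewrite loadʳ-edge (edge l) r with X []
  ... | false = refl
  ... | true  = refl
  go (false ∷ ys)
    rewrite +-assoc (length ys) 2 t | shift-right (edge l) (mark false) (filled ys ++ edge r)
          | sweep-right X (2 + t) final mark (λ b → b) (λ { false → refl ; true → refl })
              ys (mark false ∷ edge l) (edge r) []
          | map-id ys = answer _ ys (1 + t)
  go (true ∷ ys)
    rewrite +-assoc (length ys) 2 t | +-suc (length ys) (1 + t)
          | sweep-right X (1 + t) final mark (λ b → b) (λ { false → refl ; true → refl })
              (true ∷ ys) (edge l) (edge r) (true ∷ [])
          | map-id ys = answer _ (true ∷ true ∷ ys) t

-- The number n of cells never changes, so all rounds cost the same 2n + 4. Starting with n bits,
-- the rounds and the n + 2 steps of `finish` add up to `solverBound`.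
solver-rounds : ∀ X l r us ys n → length us + length ys ≡ n → ∃[ qs ]
  runFrom X (length us * (2 * n + 4) + (n + 2)) (roundStart l r us ys) ≡
  just (qs , X (target (fill X (length us) ys)))
solver-rounds X l r [] ys _ refl
  with finish X 0 l r ys
... | qs , eq rewrite +-identityʳ (length ys + 2) = qs , eq
solver-rounds X l r (b ∷ us) ys n refl
  with solver-rounds X true true us (X (address (length (b ∷ us)) ys) ∷ ys) n
                     (+-suc (length us) (length ys))
... | qs , eq
  rewrite +-assoc (2 * n + 4) (length us * (2 * n + 4)) (n + 2)
        | round X (length us * (2 * n + 4) + (n + 2)) l r b us ys | eq = _ , refl

solverBound : Polynomial
solverBound = 2 ∷ 5 ∷ 2 ∷ []

solver-run : ∀ X x → ∃[ qs ]
  run solver X (eval solverBound (length x)) x ≡ just (qs , X (target (fill X (length x) [])))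
solver-run X x with solver-rounds X false false (reverse x) [] (length x)
                      (trans (+-identityʳ _) (length-reverse x))
... | qs , eq = qs , trans (cong₂ (runFrom X) time initially)
  (trans eq (cong (λ n → just (qs , X (target (fill X n [])))) (length-reverse x)))
  where
  open +-*-Solver
  time : eval solverBound (length x) ≡ length (reverse x) * (2 * length x + 4) + (length x + 2)
  time rewrite length-reverse x = polynomial (length x)
    where
    polynomial : ∀ n → 2 + n * (5 + n * (2 + n * 0)) ≡ n * (2 * n + 4) + (n + 2)
    polynomial = solve 1 (λ n → con 2 :+ n :* (con 5 :+ n :* (con 2 :+ n :* con 0)) :=
      n :* (con 2 :* n :+ con 4) :+ (n :+ con 2)) refl
  initially : initial x ≡ roundStart false false (reverse x) []
  initially = cong (λ T → at scan T [])
    (trans (input x) (sym (cong (loadʳ []) (map-reverse-ʳ++ bit x))))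
    where
    input : ∀ x → inputTape x ≡ loadʳ [] (map bit x ++ [])
    input [] = refl
    input (b ∷ x) = cong (tape [] (bit b)) (sym (++-identityʳ _))

-- Enumeration of the clocked machines

open RightInverse using (to; from; strictlyInverseʳ)

retract : ∀ {A B : Set} (f : A → B) (g : B → A) → (∀ x → g (f x) ≡ x) → A ↪ B
retract f g p = mk↪ {to = f} {from = g} λ { refl → p _ }

-- Prefix codes: decoding stops at the end of the code word and returns the
-- rest of the input, so that codes can be concatenated.
record Code (A : Set) : Set where
  field
    encode        : A → Word
    decode        : Word → Maybe (A × Word)
    decode-encode : ∀ a w → decode (encode a ++ w) ≡ just (a , w)

open Code

⊤-code : Code ⊤
⊤-code = record
  { encode = λ _ → [] ; decode = λ w → just (tt , w) ; decode-encode = λ _ _ → refl }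

via : ∀ {A B} → A ↪ B → Code B → Code A
via r C .encode a          = encode C (to r a)
via r C .decode w          = Maybe.map (map₁ (from r)) (decode C w)
via r C .decode-encode a w
  rewrite decode-encode C (to r a) w | strictlyInverseʳ r a = refl

⊎-code : ∀ {A B} → Code A → Code B → Code (A ⊎ B)
⊎-code C D .encode (inj₁ a) = false ∷ encode C a
⊎-code C D .encode (inj₂ b) = true ∷ encode D b
⊎-code C D .decode []          = nothing
⊎-code C D .decode (false ∷ w) = Maybe.map (map₁ inj₁) (decode C w)
⊎-code C D .decode (true ∷ w)  = Maybe.map (map₁ inj₂) (decode D w)
⊎-code C D .decode-encode (inj₁ a) w rewrite decode-encode C a w = refl
⊎-code C D .decode-encode (inj₂ b) w rewrite decode-encode D b w = refl

Σ-code : ∀ {A} {B : A → Set} → Code A → (∀ a → Code (B a)) → Code (Σ A B)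
Σ-code C D .encode (a , b) = encode C a ++ encode (D a) b
Σ-code C D .decode w =
  decode C w >>= λ (a , v) → Maybe.map (map₁ (a ,_)) (decode (D a) v)
Σ-code C D .decode-encode (a , b) w
  rewrite ++-assoc (encode C a) (encode (D a) b) w
        | decode-encode C a (encode (D a) b ++ w) | decode-encode (D a) b w = refl

×-code : ∀ {A B} → Code A → Code B → Code (A × B)
×-code C D = Σ-code C (λ _ → D)

Bool-code : Code Bool
Bool-code = via (retract (λ { false → inj₁ tt ; true → inj₂ tt })
                         (λ { (inj₁ _) → false ; (inj₂ _) → true })
                         (λ { false → refl ; true → refl }))
                (⊎-code ⊤-code ⊤-code)

Maybe-code : ∀ {A} → Code A → Code (Maybe A)
Maybe-code C = via (retract (λ { nothing → inj₁ tt ; (just a) → inj₂ a })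
                            (λ { (inj₁ _) → nothing ; (inj₂ a) → just a })
                            (λ { nothing → refl ; (just _) → refl }))
                   (⊎-code ⊤-code C)

Fin-code : ∀ n → Code (Fin n)
Fin-code zero = record { encode = λ () ; decode = λ _ → nothing ; decode-encode = λ () }
Fin-code (suc n) = via (retract (λ { zero → nothing ; (suc i) → just i })
                                (λ { nothing → zero ; (just i) → suc i })
                                (λ { zero → refl ; (suc _) → refl }))
                       (Maybe-code (Fin-code n))

ℕ-code : Code ℕ
ℕ-code .encode zero    = false ∷ []
ℕ-code .encode (suc n) = true ∷ encode ℕ-code n
ℕ-code .decode []          = nothing
ℕ-code .decode (false ∷ w) = just (zero , w)
ℕ-code .decode (true ∷ w)  = Maybe.map (map₁ suc) (decode ℕ-code w)
ℕ-code .decode-encode zero    w = refl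
ℕ-code .decode-encode (suc n) w rewrite decode-encode ℕ-code n w = refl

Vec-code : ∀ {A} → Code A → ∀ n → Code (Vec A n)
Vec-code C zero    = via (retract (λ _ → tt) (λ _ → []) (λ { [] → refl })) ⊤-code
Vec-code C (suc n) = via (retract (λ { (a ∷ v) → a , v }) (λ (a , v) → a ∷ v)
                                  (λ { (_ ∷ _) → refl }))
                         (×-code C (Vec-code C n))

List-code : ∀ {A} → Code A → Code (List A)
List-code C = via (retract (λ l → length l , Vec.fromList l) (λ (_ , v) → Vec.toList v)
                           toList∘fromList)
                  (Σ-code ℕ-code (Vec-code C))

Symbol-code : ∀ g → Code (Symbol g)
Symbol-code g =
  via (retract (λ { blank → nothing ; (bit b) → just (inj₁ b) ; (aux i) → just (inj₂ i) })
               (λ { nothing → blank ; (just (inj₁ b)) → bit b ; (just (inj₂ i)) → aux i })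
               (λ { blank → refl ; (bit _) → refl ; (aux _) → refl }))
      (Maybe-code (⊎-code Bool-code (Fin-code g)))

Direction-code : Code Direction
Direction-code = via (retract (λ { stay → nothing ; left → just false ; right → just true })
                              (λ { nothing → stay ; (just false) → left ; (just true) → right })
                              (λ { stay → refl ; left → refl ; right → refl }))
                     (Maybe-code Bool-code)

Instruction-code : ∀ s k g → Code (Instruction s k g)
Instruction-code s k g =
  via (retract (λ { (halt a) → inj₁ a
                  ; (query n y) → inj₂ (inj₁ (n , y))
                  ; (work s v m) → inj₂ (inj₂ (s , v , m)) })
               (λ { (inj₁ a) → halt a
                  ; (inj₂ (inj₁ (n , y))) → query n y
                  ; (inj₂ (inj₂ (s , v , m))) → work s v m })
               (λ { (halt _) → refl ; (query _ _) → refl ; (work _ _ _) → refl }))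
      (⊎-code Bool-code
        (⊎-code (×-code (Fin-code s) (Fin-code s))
          (×-code (Fin-code s)
            (×-code (Vec-code (×-code (Symbol-code g) Direction-code) k)
                    (Maybe-code Bool-code)))))

-- This is bijective base two: the constructors `2[1+_]` and `1+[2_]` are its two digits.
Word↪ℕ : Word ↪ ℕ
Word↪ℕ = retract (ℕᵇ.toℕ ∘ toBinary) (fromBinary ∘ ℕᵇ.fromℕ)
                 λ w → trans (cong fromBinary (fromℕ-toℕ (toBinary w))) (fromBinary-toBinary w)
  where
  toBinary : Word → ℕᵇ
  toBinary []          = ℕᵇ.zero
  toBinary (false ∷ w) = 2[1+ toBinary w ]
  toBinary (true ∷ w)  = 1+[2 toBinary w ]
  fromBinary : ℕᵇ → Word
  fromBinary ℕᵇ.zero  = []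
  fromBinary 2[1+ n ] = false ∷ fromBinary n
  fromBinary 1+[2 n ] = true ∷ fromBinary n
  fromBinary-toBinary : ∀ w → fromBinary (toBinary w) ≡ w
  fromBinary-toBinary []          = refl
  fromBinary-toBinary (false ∷ w) = cong (false ∷_) (fromBinary-toBinary w)
  fromBinary-toBinary (true ∷ w)  = cong (true ∷_) (fromBinary-toBinary w)

enumerate : ∀ {A} → Code A → ℕ → Maybe A
enumerate C n = Maybe.map proj₁ (decode C (from Word↪ℕ n))

enumerate-onto : ∀ {A} (C : Code A) a → ∃[ n ] enumerate C n ≡ just a
enumerate-onto C a = to Word↪ℕ (encode C a ++ []) ,
  trans (cong (Maybe.map proj₁ ∘ decode C) (strictlyInverseʳ Word↪ℕ _))
        (cong (Maybe.map proj₁) (decode-encode C a []))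

-- Programs as finite tables

Symbol↪Fin : ∀ g → Symbol g ↪ Fin (3 + g)
Symbol↪Fin g = retract (λ { (bit false) → zero ; (bit true) → suc zero ; blank → suc (suc zero)
                          ; (aux i) → suc (suc (suc i)) })
                       (λ { zero → bit false ; (suc zero) → bit true ; (suc (suc zero)) → blank
                          ; (suc (suc (suc i))) → aux i })
                       (λ { (bit false) → refl ; (bit true) → refl ; blank → refl ; (aux _) → refl })

×↪Fin : ∀ {A B : Set} {m n} → A ↪ Fin m → B ↪ Fin n → (A × B) ↪ Fin (m * n)
×↪Fin r s = ↔⇒↪ (↔-sym *↔×) ↪-∘ (r ×-↪ s)

Vec↪Fin : ∀ {A : Set} {m} → A ↪ Fin m → ∀ n → Vec A n ↪ Fin (m ^ n)
Vec↪Fin r zero    = retract (λ _ → zero) (λ _ → []) (λ { [] → refl })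
Vec↪Fin r (suc n) = ×↪Fin r (Vec↪Fin r n) ↪-∘
  retract (λ { (a ∷ v) → a , v }) (λ (a , v) → a ∷ v) (λ { (_ ∷ _) → refl })

situation↪Fin : ∀ s k g → (Fin s × Vec (Symbol g) k) ↪ Fin (s * (3 + g) ^ k)
situation↪Fin s k g = ×↪Fin (↪-id _) (Vec↪Fin (Symbol↪Fin g) k)

-- A program is a function and has no code as such. Its domain is finite, so it is replaced by the
-- vector of its values, indexed through `situation↪Fin`.
Table : Set
Table = ∃[ s ] ∃[ k ] ∃[ g ] (Fin s × Vec (Instruction s (suc k) g) (s * (3 + g) ^ suc k))

Table-code : Code Table
Table-code = Σ-code ℕ-code λ s → Σ-code ℕ-code λ k → Σ-code ℕ-code λ g →
  ×-code (Fin-code s) (Vec-code (Instruction-code s (suc k) g) _)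

machineOf : Table → OracleTM
machineOf (s , k , g , q , table) = record
  { states = s ; extraTapes = k ; auxSymbols = g ; start = q
  ; program = λ s′ v → Vec.lookup table (to (situation↪Fin s (suc k) g) (s′ , v)) }

tableOf : OracleTM → Table
tableOf M = states , extraTapes , auxSymbols , start ,
  Vec.tabulate (λ i → let (s , v) = from (situation↪Fin _ _ _) i in program s v)
  where open OracleTM M

-- Tabulating a program returns one that is only pointwise equal to it; without extensionality the
-- equality has to be carried through the runs.
run-cong : ∀ {s k g} start (π ρ : Fin s → Vec (Symbol g) (suc k) → Instruction s (suc k) g) →
  (∀ q v → π q v ≡ ρ q v) → ∀ X t x →
  run (record { start = start ; program = π }) X t x ≡
  run (record { start = start ; program = ρ }) X t x
run-cong start π ρ π≗ρ X t x = go t start _ []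
  where
  M = record { start = start ; program = π }
  N = record { start = start ; program = ρ }
  go : ∀ t q ts w → Run.runFrom M X t (Run.config q ts w) ≡ Run.runFrom N X t (Run.config q ts w)
  go t q ts w with π q (Vec.map scanned ts) | ρ q (Vec.map scanned ts) | π≗ρ q (Vec.map scanned ts)
  go t       q ts w | halt _     | _ | refl = refl
  go zero    q ts w | query _ _  | _ | refl = refl
  go (suc t) q ts w | query n y  | _ | refl = cong (Maybe.map _) (go t (if X w then y else n) ts [])
  go zero    q ts w | work _ _ _ | _ | refl = refl
  -- Each machine has its own instance of `append`; the two instances meet only after the split on
  -- the bit.
  go (suc t) q ts w | work s as nothing  | _ | refl = go t s _ _
  go (suc t) q ts w | work s as (just b) | _ | refl = go t s _ _

run-table : ∀ M X t x → run (machineOf (tableOf M)) X t x ≡ run M X t x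
run-table M = run-cong start _ program λ q v →
  trans (lookup∘tabulate _ (to (situation↪Fin _ _ _) (q , v)))
        (cong (λ (q , v) → program q v) (strictlyInverseʳ (situation↪Fin _ _ _) (q , v)))
  where open OracleTM M

-- Diagonalisation

n<2^n : ∀ n → n < 2 ^ n
n<2^n zero    = s≤s z≤n
n<2^n (suc n) = begin-strict
  1 + n         <⟨ +-monoʳ-< 1 (n<2^n n) ⟩
  1 + 2 ^ n     ≤⟨ +-monoˡ-≤ (2 ^ n) (m^n>0 2 n) ⟩
  2 ^ n + 2 ^ n ≡⟨ cong (2 ^ n +_) (sym (+-identityʳ _)) ⟩
  2 ^ suc n     ∎
  where open ≤-Reasoning

1+3n≤4^n : ∀ n → 1 + 3 * n ≤ 4 ^ n
1+3n≤4^n zero    = ≤-refl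
1+3n≤4^n (suc n) = begin
  1 + 3 * suc n           ≡⟨ cong suc (*-suc 3 n) ⟩
  4 + 3 * n               ≤⟨ +-monoʳ-≤ 4 (*-monoˡ-≤ n {3} {12} (s≤s (s≤s (s≤s z≤n)))) ⟩
  4 + 12 * n              ≡⟨ cong (4 +_) (*-assoc 4 3 n) ⟩
  4 + 4 * (3 * n)         ≡⟨ sym (*-suc 4 (3 * n)) ⟩
  4 * (1 + 3 * n)         ≤⟨ *-monoʳ-≤ 4 (1+3n≤4^n n) ⟩
  4 ^ suc n               ∎
  where open ≤-Reasoning

-- Along Horner's scheme, multiplying by n costs k in the exponent, and adding a coefficient a costs
-- at most a, since a + z ≤ (1 + a)z ≤ 2ᵃz for z ≥ 1.
eval≤2^ : ∀ p n k → n ≤ 2 ^ k → eval p n ≤ 2 ^ (sum p + k * length p)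
eval≤2^ []      n k n≤ = z≤n
eval≤2^ (a ∷ p) n k n≤ = begin
  a + n * eval p n          ≤⟨ +-monoʳ-≤ a (*-mono-≤ n≤ (eval≤2^ p n k n≤)) ⟩
  a + z                     ≡⟨ +-comm a z ⟩
  z + a                     ≤⟨ +-monoʳ-≤ z (m≤m*n a z {{>-nonZero z>0}}) ⟩
  suc a * z                 ≤⟨ *-monoˡ-≤ z (n<2^n a) ⟩
  2 ^ a * z                 ≡⟨ cong (2 ^ a *_) (sym (^-distribˡ-+-* 2 k e)) ⟩
  2 ^ a * 2 ^ (k + e)       ≡⟨ sym (^-distribˡ-+-* 2 a (k + e)) ⟩
  2 ^ (a + (k + e))         ≡⟨ cong (2 ^_) exponent ⟩
  2 ^ (sum (a ∷ p) + k * length (a ∷ p)) ∎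
  where
  open ≤-Reasoning
  e z : ℕ
  e = sum p + k * length p
  z = 2 ^ k * 2 ^ e
  z>0 : 1 ≤ z
  z>0 = *-mono-≤ (m^n>0 2 k) (m^n>0 2 e)
  exponent : a + (k + e) ≡ a + sum p + k * suc (length p)
  exponent rewrite *-suc k (length p) | +-assoc a (sum p) (k + k * length p)
    | sym (+-assoc k (sum p) (k * length p)) | +-comm k (sum p)
    | +-assoc (sum p) k (k * length p) = refl

abstract
  -- For m = 2ʲ the value of p at 1 + m is at most 2 to an exponent linear in j, which a large j
  -- keeps below 2ʲ. Being abstract, m never unfolds in the stages.
  eventually-small : ∀ p N → ∃[ m ] (N ≤ m × eval p (suc m) < 2 ^ m)
  eventually-small p N = 2 ^ j , N≤m ,
    ≤-<-trans (eval≤2^ p _ (suc j) 1+m≤) (^-monoʳ-< 2 ≤-refl exponent)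
    where
    open ≤-Reasoning
    -- In 2ʲ = 4ᶜ2ᶜ the factor 4ᶜ covers 1 + j and 2ᶜ exceeds c; the summand N makes m reach N.
    c j : ℕ
    c = sum p + length p + N
    j = 3 * c
    N≤m : N ≤ 2 ^ j
    N≤m = begin
      N     ≤⟨ m≤n+m N (sum p + length p) ⟩
      c     ≤⟨ m≤n*m c 3 ⟩
      j     ≤⟨ <⇒≤ (n<2^n j) ⟩
      2 ^ j ∎
    1+m≤ : suc (2 ^ j) ≤ 2 ^ suc j
    1+m≤ = begin
      1 + 2 ^ j     ≤⟨ +-monoˡ-≤ (2 ^ j) (m^n>0 2 j) ⟩
      2 ^ j + 2 ^ j ≡⟨ cong (2 ^ j +_) (sym (+-identityʳ _)) ⟩
      2 ^ suc j     ∎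
    exponent : sum p + suc j * length p < 2 ^ j
    exponent = begin-strict
      sum p + suc j * length p         ≤⟨ +-monoˡ-≤ _ (m≤n*m (sum p) (suc j)) ⟩
      suc j * sum p + suc j * length p ≡⟨ sym (*-distribˡ-+ (suc j) (sum p) (length p)) ⟩
      suc j * (sum p + length p)       ≤⟨ *-monoʳ-≤ (suc j) (m≤m+n _ N) ⟩
      suc j * c                        ≤⟨ *-monoˡ-≤ c (1+3n≤4^n c) ⟩
      4 ^ c * c                        <⟨ *-monoʳ-< (4 ^ c) {{m^n≢0 4 c}} (n<2^n c) ⟩
      4 ^ c * 2 ^ c                    ≡⟨ *-comm (4 ^ c) (2 ^ c) ⟩
      2 ^ c * 4 ^ c                    ≡⟨ cong (2 ^ c *_) (^-*-assoc 2 2 c) ⟩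
      2 ^ c * 2 ^ (2 * c)              ≡⟨ sym (^-distribˡ-+-* 2 c (2 * c)) ⟩
      2 ^ j                            ∎

-- Words missed by a short list

below : Bool → List Word → List Word
below b     []                 = []
below b     ([] ∷ ws)          = below b ws
below false ((false ∷ w) ∷ ws) = w ∷ below false ws
below false ((true ∷ w) ∷ ws)  = below false ws
below true  ((false ∷ w) ∷ ws) = below true ws
below true  ((true ∷ w) ∷ ws)  = w ∷ below true ws

∈-below : ∀ b {w ws} → (b ∷ w) ∈ ws → w ∈ below b ws
∈-below false (here refl) = here refl
∈-below true  (here refl) = here refl
∈-below b     {ws = [] ∷ ws}           (there i) = ∈-below b i
∈-below false {ws = (false ∷ _) ∷ ws} (there i) = there (∈-below false i)
∈-below false {ws = (true ∷ _) ∷ ws}  (there i) = ∈-below false i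
∈-below true  {ws = (false ∷ _) ∷ ws} (there i) = ∈-below true i
∈-below true  {ws = (true ∷ _) ∷ ws}  (there i) = there (∈-below true i)

length-below : ∀ ws → length (below false ws) + length (below true ws) ≤ length ws
length-below []                 = z≤n
length-below ([] ∷ ws)          = m≤n⇒m≤1+n (length-below ws)
length-below ((false ∷ _) ∷ ws) = s≤s (length-below ws)
length-below ((true ∷ _) ∷ ws)
  rewrite +-suc (length (below false ws)) (length (below true ws)) = s≤s (length-below ws)

-- Pigeonhole by bisection: if the words starting with `false` number at least 2ᵐ, fewer than 2ᵐ are
-- left to start with `true`.
fresh-word : ∀ m (ws : List Word) → length ws < 2 ^ m → ∃[ y ] (length y ≡ m × y ∉ ws)
fresh-word zero    []      _ = [] , refl , λ ()
fresh-word zero    (_ ∷ _) (s≤s ())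
fresh-word (suc m) ws      lt with length (below false ws) <? 2 ^ m
... | yes lt₀ = let y , len , y∉ = fresh-word m (below false ws) lt₀ in
                false ∷ y , cong suc len , y∉ ∘ ∈-below false
... | no  ge₀ = let y , len , y∉ = fresh-word m (below true ws) lt₁ in
                true ∷ y , cong suc len , y∉ ∘ ∈-below true
  where
  lt₁ : length (below true ws) < 2 ^ m
  lt₁ = +-cancelˡ-< (2 ^ m) _ _ (≤-<-trans (+-monoˡ-≤ _ (≮⇒≥ ge₀))
          (≤-<-trans (length-below ws)
            (<-≤-trans lt (≤-reflexive (cong (2 ^ m +_) (+-identityʳ _))))))

-- Oracles that spell a given word

nth : Word → ℕ → Bool
nth []      _       = false
nth (b ∷ _) zero    = b
nth (_ ∷ y) (suc i) = nth y i

zeros : Word → ℕ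
zeros []          = 0
zeros (false ∷ w) = suc (zeros w)
zeros (true ∷ w)  = zeros w

zeros-address : ∀ u ys → zeros (address u ys) ≡ u
zeros-address zero    []       = refl
zeros-address zero    (_ ∷ ys) = zeros-address zero ys
zeros-address (suc u) ys       = cong suc (zeros-address u ys)

length-address : ∀ u ys → length (address u ys) ≡ u + length ys
length-address u ys = trans (length-++ (replicate u false))
  (cong₂ _+_ (length-replicate u) (length-map _ ys))

nth-drop : ∀ y u → u < length y → nth y u ∷ drop (suc u) y ≡ drop u y
nth-drop (_ ∷ _) zero    _        = refl
nth-drop (_ ∷ y) (suc u) (s≤s lt) = nth-drop y u lt

-- With u cells still open the marks read `drop u y`; the next question has u zeros, so its answer
-- is the letter just before that suffix.
fill-spelled : ∀ X y → (∀ q → length q ≡ length y → X q ≡ nth y (pred (zeros q))) →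
               fill X (length y) [] ≡ y
fill-spelled X y spelled =
  trans (cong (fill X (length y)) (sym (drop-all (length y) y ≤-refl))) (go (length y) ≤-refl)
  where
  go : ∀ u → u ≤ length y → fill X u (drop u y) ≡ y
  go zero    _  = refl
  go (suc u) lt = trans (cong (λ b → fill X u (b ∷ drop (suc u) y)) answer)
    (trans (cong (fill X u) (nth-drop y u lt)) (go u (<⇒≤ lt)))
    where
    answer : X (address (suc u) (drop (suc u) y)) ≡ nth y u
    answer = trans
      (spelled _ (trans (length-address (suc u) (drop (suc u) y))
                        (trans (cong (suc u +_) (length-drop (suc u) y)) (m+[n∸m]≡n lt))))
      (cong (nth y ∘ pred) (zeros-address (suc u) (drop (suc u) y)))

-- The query that determines the cell with index i starts with i + 1 zeros.
spell : Word → Language → Language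
spell y X q = if does (length q ≟ length y) then nth y (pred (zeros q)) else X q

spell-≡ : ∀ y X q → length q ≡ length y → spell y X q ≡ nth y (pred (zeros q))
spell-≡ y X q eq =
  cong (λ d → if d then nth y (pred (zeros q)) else X q) (dec-true (length q ≟ length y) eq)

spell-≢ : ∀ y X q → length q ≢ length y → spell y X q ≡ X q
spell-≢ y X q ne =
  cong (λ d → if d then nth y (pred (zeros q)) else X q) (dec-false (length q ≟ length y) ne)

_[_↦_] : Language → Word → Bool → Language
(X [ w ↦ b ]) q = if does (q ≟ʷ w) then b else X q

update-≡ : ∀ X w b → (X [ w ↦ b ]) w ≡ b
update-≡ X w b = cong (λ d → if d then b else X w) (dec-true (w ≟ʷ w) refl)

update-≢ : ∀ X w b q → q ≢ w → (X [ w ↦ b ]) q ≡ X q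
update-≢ X w b q ne = cong (λ d → if d then b else X q) (dec-false (q ≟ʷ w) ne)

_agreesWith_below_ : Language → Language → ℕ → Set
X agreesWith Y below N = ∀ w → length w < N → X w ≡ Y w

-- true stands for lni and false for lnd.  The flag of a stage is also the first
-- bit of the word spelt there, which makes the final query of the wrong length.
Order : Bool → Word → Word → Set
Order true  u v = length u ≥ length v
Order false u v = length u ≤ length v

Order-trans : ∀ k {u v w} → Order k u v → Order k v w → Order k u w
Order-trans true  p q = ≤-trans q p
Order-trans false p q = ≤-trans p q

solved : Language → Language
solved X x = X (target (fill X (length x) []))

-- Machines and polynomials can be enumerated, proofs of halting cannot. The stages therefore treat
-- all pairs, and halting becomes a hypothesis to be refuted along with the rest.
Solves : Bool → OracleTM → Polynomial → Language → Set
Solves k M p A =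
  (∀ X x → ∃[ r ] run M X (eval p (length x)) x ≡ just r) ×
  (∀ x → ∃[ qs ] (run M A (eval p (length x)) x ≡ just (qs , solved A x) × Linked (Order k) qs))

-- A single stage

module Diagonalisation (M : OracleTM) (p : Polynomial) (k : Bool) (N : ℕ) (X : Language) where

  m : ℕ
  m = proj₁ (eventually-small p N)

  N≤m : N ≤ m
  N≤m = proj₁ (proj₂ (eventually-small p N))

  x : Word
  x = replicate (suc m) false

  t : ℕ
  t = eval p (length x)

  t<2^m : t < 2 ^ m
  t<2^m rewrite length-replicate m {false} = proj₂ (proj₂ (eventually-small p N))

  -- The default is never used for a machine that halts in time.
  result : Language → List Word × Bool
  result Y = fromMaybe ([] , false) (run M Y t x)

  result-≡ : ∀ {Y r} → run M Y t x ≡ just r → result Y ≡ r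
  result-≡ = cong (fromMaybe ([] , false))

  few-queries : ∀ Y → length (proj₁ (result Y)) ≤ t
  few-queries Y with run M Y t x in eq
  ... | nothing = z≤n
  ... | just _  = Computations.length-queries M Y t _ eq

  suffix : Bool → Word → Word
  suffix true  = drop 2
  suffix false = id

  suffix-target : ∀ k y → suffix k (target (k ∷ y)) ≡ y
  suffix-target true  y = refl
  suffix-target false y = refl

  -- The run counted here uses the old oracle `X`, in which nothing of the new word is spelt yet; it
  -- is too short to ask for all 2ᵐ possible final queries.
  unasked : ∃[ y ] (length y ≡ m × y ∉ map (suffix k) (proj₁ (result X)))
  unasked = fresh-word m _ (≤-<-trans
    (≤-trans (≤-reflexive (length-map _ (proj₁ (result X)))) (few-queries X)) t<2^m)

  y w : Word
  y = k ∷ proj₁ unasked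
  w = target y

  length-y : length y ≡ suc m
  length-y = cong suc (proj₁ (proj₂ unasked))

  w∉ : w ∉ proj₁ (result X)
  w∉ i = proj₂ (proj₂ unasked) (subst (_∈ map (suffix k) (proj₁ (result X)))
    (suffix-target k _) (∈-map⁺ (suffix k) i))

  -- The verdict to contradict is the one under `Y`, because a machine that never asks `w` cannot
  -- tell `Z` from `Y`.
  Y Z : Language
  Y = spell y X
  Z = Y [ w ↦ not (proj₂ (result Y)) ]

  -- This exceeds the length of `w`, at most m + 2, and of every query, at most t.
  N′ : ℕ
  N′ = 3 + m + t

  N<N′ : N < N′
  N<N′ = s≤s (≤-trans N≤m (≤-trans (m≤n+m m 2) (m≤m+n _ t)))

  length-target : ∀ k {y} → length y ≡ m → length (target (k ∷ y)) ≡ (if k then 2 + m else m)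
  length-target true  = cong (2 +_)
  length-target false = id

  w-length : length w ≡ (if k then 2 + m else m)
  w-length = length-target k (proj₁ (proj₂ unasked))

  m≤w : m ≤ length w
  m≤w = subst (m ≤_) (sym w-length) (go k)
    where
    go : ∀ k → m ≤ (if k then 2 + m else m)
    go true  = m≤n+m m 2
    go false = ≤-refl

  w≤ : length w ≤ 2 + m
  w≤ = subst (_≤ 2 + m) (sym w-length) (go k)
    where
    go : ∀ k → (if k then 2 + m else m) ≤ 2 + m
    go true  = ≤-refl
    go false = m≤n+m m 2

  -- This is where the order of lengths matters: whatever precedes the final query has length at
  -- least m + 2 or at most m, hence reveals nothing of the spelt word.
  separated : ∀ k {u v} → length v ≡ (if k then 2 + m else m) → Order k u v → length u ≢ suc m
  separated true  eq le lu = <-irrefl refl (subst₂ _≤_ eq lu le)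
  separated false eq le lu = <-irrefl refl (subst₂ _≤_ lu eq le)

  Order-refl : ∀ k {u} → Order k u u
  Order-refl true  = ≤-refl
  Order-refl false = ≤-refl

  Y-≡ : ∀ q → length q ≢ suc m → Y q ≡ X q
  Y-≡ q ne = spell-≢ y X q λ eq → ne (trans eq length-y)

  Z-≡ : ∀ q → q ≢ w → Z q ≡ Y q
  Z-≡ = update-≢ Y w _

  Z-agrees : Z agreesWith X below N
  Z-agrees q lt = trans (Z-≡ q λ { refl → <-irrefl refl (<-≤-trans lt (≤-trans N≤m m≤w)) })
                        (Y-≡ q λ eq → <-irrefl eq (<-≤-trans lt (m≤n⇒m≤1+n N≤m)))

  defeated : ∀ A → A agreesWith Z below N′ → ¬ Solves k M p A
  defeated A A≈Z (halting , solving) with solving x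
  ... | qs , runA , linked = conclude (w ∈? qs)
    where
    open Computations M
    open DecMembership _≟ʷ_ using (_∈?_)

    b : Bool
    b = proj₂ (result Y)

    short : ∀ {q} → q ∈ qs → A q ≡ Z q
    short q∈ = A≈Z _ (s≤s (≤-trans (All.lookup (queries-short A t _ runA) q∈) (m≤n+m t _)))

    filled-in : fill A (length x) [] ≡ y
    filled-in = trans (cong (λ n → fill A n []) (trans (length-replicate (suc m)) (sym length-y)))
      (fill-spelled A y λ q eq →
        trans (A≈Z q (subst (_< N′) (sym (trans eq length-y))
                            (s≤s (s≤s (≤-trans (n≤1+n m) (m≤m+n _ t))))))
        -- The final query itself avoids length m + 1, so changing its answer leaves the spelling
        -- intact.
        (trans (Z-≡ q λ { refl → separated k {w} w-length (Order-refl k {w}) (trans eq length-y) })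
               (spell-≡ y X q eq)))

    value : solved A x ≡ not b
    value = trans (cong (A ∘ target) filled-in)
      (trans (A≈Z w (s≤s (≤-trans w≤ (m≤m+n _ t)))) (update-≡ Y w (not b)))

    conclude : Dec (w ∈ qs) → _
    -- Before the first `w` no query has length m + 1, and on the other queries asked `A` can differ
    -- from `X` only at `w`. The run with oracle `X` would thus ask `w` as well.
    conclude (yes w∈) = w∉ (subst (λ r → w ∈ proj₁ r) (sym (result-≡ (proj₂ (halting X x))))
      (query-transfer t _ runA (proj₂ (halting X x)) (Linked⇒AllPairs (Order-trans k) linked) w∈
        λ {q} q∈ q~w q≢w → trans (short q∈) (trans (Z-≡ q q≢w) (Y-≡ q (separated k w-length q~w)))))
    -- If `w` is not asked, `A` answers every query as `Y` does, so the verdict is `b`, whereas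
    -- `value` demands its negation.
    conclude (no w∉qs) = Bool.not-¬ {x = b} refl (sym (trans (sym value) (sym (cong proj₂
      (result-≡ (run-agree t _ runA (All.tabulate λ {q} q∈ →
        trans (short q∈) (Z-≡ q λ { refl → w∉qs q∈ }))))))))

-- All stages and the limit oracle

Requirement : Set
Requirement = Table × Polynomial × Bool

Requirement-code : Code Requirement
Requirement-code = ×-code Table-code (×-code (List-code ℕ-code) Bool-code)

abstract
  -- Kept abstract so that the decoder does not unfold inside the stages.
  requirement : ℕ → Maybe Requirement
  requirement = enumerate Requirement-code

  requirement-onto : ∀ r → ∃[ n ] requirement n ≡ just r
  requirement-onto = enumerate-onto Requirement-code

-- The length below which the oracle is final, and the oracle built so far.
Stage : Set
Stage = ℕ × Language

extend : Maybe Requirement → Stage → Stage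
-- A number that codes nothing still raises the ceiling, so that the ceilings pass every length.
extend nothing            (N , X) = suc N , X
extend (just (T , p , k)) (N , X) = N′ , Z
  where open Diagonalisation (machineOf T) p k N X using (N′; Z)

extend-grows : ∀ r s → proj₁ s < proj₁ (extend r s)
extend-grows nothing            (N , X) = ≤-refl
extend-grows (just (T , p , k)) (N , X) = Diagonalisation.N<N′ (machineOf T) p k N X

extend-agrees : ∀ r s → proj₂ (extend r s) agreesWith proj₂ s below proj₁ s
extend-agrees nothing            (N , X) = λ _ _ → refl
extend-agrees (just (T , p , k)) (N , X) = Diagonalisation.Z-agrees (machineOf T) p k N X

stage : ℕ → Stage
stage zero    = 0 , λ _ → false
stage (suc e) = extend (requirement e) (stage e)

stage-grows : ∀ e → e ≤ proj₁ (stage e)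
stage-grows zero    = z≤n
stage-grows (suc e) = ≤-<-trans (stage-grows e) (extend-grows (requirement e) (stage e))

ceiling-mono : ∀ {d e} → d ≤′ e → proj₁ (stage d) ≤ proj₁ (stage e)
ceiling-mono ≤′-refl = ≤-refl
ceiling-mono (≤′-step {e} le) =
  ≤-trans (ceiling-mono le) (<⇒≤ (extend-grows (requirement e) (stage e)))

stage-agrees : ∀ {d e} → d ≤′ e → proj₂ (stage e) agreesWith proj₂ (stage d) below proj₁ (stage d)
stage-agrees ≤′-refl          w lt = refl
stage-agrees {d} (≤′-step {e} le) w lt = trans
  (extend-agrees (requirement e) (stage e) w (<-≤-trans lt (ceiling-mono le)))
  (stage-agrees le w lt)

-- The limit is read off at a finite stage: by `stage-grows` the ceiling of stage |w| + 1 is above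
-- |w|, so the value at w is final there.
A : Language
A w = proj₂ (stage (suc (length w))) w

A-agrees : ∀ e → A agreesWith proj₂ (stage e) below proj₁ (stage e)
A-agrees e w lt with ≤-total e (suc (length w))
... | inj₁ le = stage-agrees (≤⇒≤′ le) w lt
... | inj₂ ge = sym (stage-agrees (≤⇒≤′ ge) w (stage-grows (suc (length w))))

-- Some stage treats the table of `M` together with `p` and `k`. That table's machine has the same
-- runs as `M` by `run-table`, so a solution by `M` would be one by the machine defeated there.
unsolvable : ∀ k M p → ¬ Solves k M p A
unsolvable k M p (halting , solving) with requirement-onto (tableOf M , p , k)
... | e , eq =
  Diagonalisation.defeated (machineOf (tableOf M)) p k (proj₁ (stage e)) (proj₂ (stage e)) A
    (subst (λ r → A agreesWith proj₂ (extend r (stage e)) below proj₁ (extend r (stage e)))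
           eq (A-agrees (suc e)))
    ((λ X x → let r , eq = halting X x in r , trans (run-table M X _ x) eq) ,
     (λ x → let qs , eq , linked = solving x in qs , trans (run-table M A _ x) eq , linked))

-- Reducibility and the two irreducibilities

to-witness-≡ : ∀ {A : Set} {m : Maybe A} (p : Is-just m) → m ≡ just (to-witness p)
to-witness-≡ (MaybeAny.just _) = refl

solver-DPTM : DPTM
solver-DPTM = record
  { machine = solver ; bound = solverBound
  ; halts = λ X x → subst Is-just (sym (proj₂ (solver-run X x))) (MaybeAny.just _) }

L-solver : ∀ X x → L solver-DPTM X x ≡ solved X x
L-solver X x = cong proj₂ (just-injective
  (trans (sym (to-witness-≡ (DPTM.halts solver-DPTM X x))) (proj₂ (solver-run X x))))

irreducible : ∀ k (D : DPTM) → L D A ≗ solved A →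
              ¬ (∀ x → Linked (Order k) (queries D A x))
irreducible k D LD linked = unsolvable k (DPTM.machine D) (DPTM.bound D)
  ((λ X x → _ , to-witness-≡ (DPTM.halts D X x)) ,
   (λ x → queries D A x ,
          trans (to-witness-≡ (DPTM.halts D A x)) (cong (λ b → just (queries D A x , b)) (LD x)) ,
          linked x))

theorem4p2 : ∃[ A ] ∃[ B ] (B ≤ᵖ-T A × ¬ (B ≤ᵖ-lni-T A) × ¬ (B ≤ᵖ-lnd-T A))
theorem4p2 = A , solved A , (solver-DPTM , L-solver A) ,
  (λ (D , LD , linked) → irreducible true D LD linked) ,
  (λ (D , LD , linked) → irreducible false D LD linked)
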